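{- Let $(I,C)$ be a hypergraph of agents and contracts in which every agent $i\in I$ has a non-empty-valued Plott choice function $f_i$ on $C(i)$. Then a meta-stable contract system $S\subseteq C$ exists.
   Context: Finite agents $I$, finite contracts $C$, each $c\in C$ with nonempty participant set $P(c)\subseteq I$; $S(i)=\{s\in S:i\in P(s)\}$. A choice function $f$ on finite $X$ satisfies $f(A)\subseteq A$; Plott means $f(A\cup B)=f(f(A)\cup B)$ for all $A,B$; non-empty-valued means $f(A)\ne\emptyset$ for $A\ne\emptyset$. An element $d$ dominates a set $A$ relative to $f$ if $A=\emptyset$ or some $a\in A$ has $a\notin f(\{a,d\})$. A contract $d$ dominates $S\subseteq C$ if for every $i\in P(d)$, $d$ dominates $S(i)$ relative to $f_i$. $S$ is meta-stable if no contract in $C$ dominates $S$. -}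

module Defs where

open import Data.Nat using (ℕ)
open import Data.Fin using (Fin)
open import Data.Fin.Subset
open import Data.Fin.Subset.Properties using (_∈?_)
open import Data.Vec using (tabulate)
open import Data.Product using (∃; _×_)
open import Data.Sum using (_⊎_)
open import Relation.Nullary using (¬_; does)
open import Relation.Binary.PropositionalEquality using (_≡_)

-- Agents are Fin n, contracts are Fin m.
-- A participant map P assigns to each contract its (nonempty) set of agents.

contractsOf : ∀ {n m} → (Fin m → Subset n) → Fin n → Subset m
contractsOf P i = tabulate (λ c → does (i ∈? P c))

restrict : ∀ {n m} → (Fin m → Subset n) → Subset m → Fin n → Subset m
restrict P S i = S ∩ contractsOf P i

-- A choice function on the finite set X ⊆ Fin m (subsets of X are the
-- subsets A of Fin m with A ⊆ X); values of f outside that domain are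
-- irrelevant.
IsChoiceFunction : ∀ {m} → Subset m → (Subset m → Subset m) → Set
IsChoiceFunction X f = ∀ A → A ⊆ X → f A ⊆ A

IsPlott : ∀ {m} → Subset m → (Subset m → Subset m) → Set
IsPlott X f = ∀ A B → A ⊆ X → B ⊆ X → f (A ∪ B) ≡ f (f A ∪ B)

IsNonEmptyValued : ∀ {m} → Subset m → (Subset m → Subset m) → Set
IsNonEmptyValued X f = ∀ A → A ⊆ X → ¬ (A ≡ ⊥) → ¬ (f A ≡ ⊥)

DominatesSet : ∀ {m} → (Subset m → Subset m) → Fin m → Subset m → Set
DominatesSet f d A = (A ≡ ⊥) ⊎ ∃ λ a → a ∈ A × a ∉ f (⁅ a ⁆ ∪ ⁅ d ⁆)

Dominates : ∀ {n m} → (Fin m → Subset n) → (Fin n → Subset m → Subset m)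
          → Fin m → Subset m → Set
Dominates P f d S = ∀ i → i ∈ P d → DominatesSet (f i) d (restrict P S i)

MetaStable : ∀ {n m} → (Fin m → Subset n) → (Fin n → Subset m → Subset m)
           → Subset m → Set
MetaStable P f S = ∀ d → ¬ Dominates P f d S

{-# OPTIONS --safe #-}
module Submission where

-- For a non-empty-valued Plott function, "a ∉ f {a , d}" is a strict partial order
-- a < d, and linearising these orders only makes domination easier.  For linear
-- orders, add to every agent i a slack contract, least for i and above all
-- contracts for the other agents, and label every contract by one of its
-- participants (a slack by its owner).  Scarf's pivoting argument, run with
-- Sperner labels in place of a linear system, yields a set of one element per label
-- such that every contract is, for some agent i, at or below the i-minimum of the
-- set.  If the i-minimum is not the slack of i, then i takes part in the element
-- labelled i, so the contracts in the set are meta-stable.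

open import Defs
open import Data.Bool using (if_then_else_)
open import Data.Nat using (ℕ; zero; suc; _+_; _*_; _^_; _≤_; _<_; z≤n; s≤s)
import Data.Nat.Properties as ℕₚ
open import Data.Nat.Induction using (<-rec)
open import Data.Fin as Fin
  using (Fin; zero; suc; toℕ; funToFin; finToFun; combine; splitAt; _↑ˡ_; _↑ʳ_)
import Data.Fin.Properties as Finₚ
open import Data.Fin.Subset
open import Data.Fin.Subset.Properties
open import Data.Product using (∃; ∃-syntax; _×_; _,_; proj₁; proj₂)
open import Data.Sum using (_⊎_; inj₁; inj₂; [_,_]′)
open import Data.Vec using (tabulate)
open import Data.Vec.Properties using (lookup∘tabulate; lookup⇒[]=; []=⇒lookup)
open import Data.Vec.Functional using (updateAt)
open import Data.Vec.Functional.Properties using (updateAt-updates; updateAt-minimal)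
open import Function using (_∘_; _on_; flip; id)
open import Function.Definitions using (Injective)
open import Level using (0ℓ)
open import Relation.Binary using (Rel; Total; Transitive; tri<; tri≈; tri>)
open import Relation.Binary.PropositionalEquality
open import Relation.Nullary using (¬_; yes; no; does; contradiction)
open import Relation.Nullary.Decidable
  using (¬?; _×-dec_; _→-dec_; decidable-stable; dec-true; dec-false)
open import Relation.Unary using (Pred; Decidable)

-- Following a path through two involutions of a finite set.

half : ∀ p → ∃[ q ] (p ≡ q + q ⊎ p ≡ suc q + q)
half zero    = zero , inj₁ refl
half (suc p) with half p
... | q , inj₁ refl = q , inj₂ refl
... | q , inj₂ refl = suc q , inj₁ (cong suc (sym (ℕₚ.+-suc q q)))

-- Follow α ∘ β from the fixed point x₀ of α.  As x₀ is the only one, the path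
-- cannot come back to x₀ unless it is reflected, which needs a fixed point of β
-- halfway; a path that never comes back contradicts finiteness.
module Involutions
  {A : Set} {N : ℕ} (code : A → Fin N) (α β : A → A) (x₀ : A)
  where

  infix 4 _≈_
  -- Elements are compared by code alone, since the flags used later contain functions and proofs.
  _≈_ : A → A → Set
  _≈_ = _≡_ on code

  module _
    (α-cong : ∀ {x y} → x ≈ y → α x ≈ α y) (α-invol : ∀ x → α (α x) ≈ x)
    (β-cong : ∀ {x y} → x ≈ y → β x ≈ β y) (β-invol : ∀ x → β (β x) ≈ x)
    (α-fixed : α x₀ ≈ x₀) (α-fixed-unique : ∀ {x} → α x ≈ x → x ≈ x₀)
    where

    private
      path : ℕ → A
      path zero    = x₀
      path (suc k) = α (β (path k))

      α-transpose : ∀ {x y} → α x ≈ y → x ≈ α y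
      α-transpose {x} e = trans (sym (α-invol x)) (α-cong e)

      β-transpose : ∀ {x y} → β x ≈ y → x ≈ β y
      β-transpose {x} e = trans (sym (β-invol x)) (β-cong e)

      -- Both involutions cancel, so a repetition at any index can be moved back to the start.
      path-shift : ∀ k p → path (k + p) ≈ path k → path p ≈ x₀
      path-shift zero    p e = e
      path-shift (suc k) p e = path-shift k p
        (trans (β-transpose (α-transpose e))
               (trans (β-cong (α-invol _)) (β-invol _)))

      -- Since `α` fixes `x₀`, a path that returns there is its own reversal: `β` matches the points
      -- whose positions add up to `p`.
      path-reflect : ∀ p → path (suc p) ≈ x₀ →
                     ∀ j i → i + j ≡ p → path i ≈ β (path j)
      path-reflect p e zero    i refl rewrite ℕₚ.+-identityʳ i =
        β-transpose (trans (α-transpose e) α-fixed)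
      path-reflect p e (suc j) i eq =
        β-transpose (α-transpose (path-reflect p e j (suc i) (trans (sym (ℕₚ.+-suc i j)) eq)))

      path-noReturn : (∀ k → k ≤ N → ¬ β (path k) ≈ path k) →
                      ∀ p → p ≤ N → ¬ path (suc p) ≈ x₀
      path-noReturn β-free = <-rec _ step
        where
        step : ∀ p → (∀ {q} → q < p → q ≤ N → ¬ path (suc q) ≈ x₀) →
               p ≤ N → ¬ path (suc p) ≈ x₀
        step p rec p≤N e with half p
        -- For even `p` the reflection has a middle point, which `β` fixes.
        ... | q , inj₁ refl = β-free q (ℕₚ.≤-trans (ℕₚ.m≤m+n q q) p≤N)
                                (sym (path-reflect p e q q refl))
        -- For odd `p` the middle is an `α`-edge, so `α` fixes `β (path q)`. That point is then
        -- `x₀`, and the path has already returned at the earlier index `suc q`.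
        ... | q , inj₂ refl = rec q<p (ℕₚ.≤-trans (ℕₚ.<⇒≤ q<p) p≤N)
                                (trans loop (α-fixed-unique loop))
          where
          q<p = s≤s (ℕₚ.m≤m+n q q)
          loop = path-reflect p e q (suc q) refl

    -- By pigeonhole two of the first `N + 1` points coincide, which forces a return to `x₀`. So `β`
    -- fixes one of these points.
    involution-fixed : ∃[ x ] β x ≈ x
    involution-fixed
      with Finₚ.any? {suc N} (λ k → code (β (path (toℕ k))) Fin.≟ code (path (toℕ k)))
    ... | yes (k , e) = path (toℕ k) , e
    ... | no β-free
      with i , j , i<j , e ← Finₚ.pigeonhole (ℕₚ.n<1+n N) (code ∘ path ∘ toℕ)
      with d , i+d≡j ← ℕₚ.m≤n⇒∃[o]m+o≡n i<j
      = contradiction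
          (path-shift (toℕ i) (suc d)
            (trans (cong (code ∘ path) (trans (ℕₚ.+-suc (toℕ i) d) i+d≡j)) (sym e)))
          (path-noReturn
            (λ k k≤N f → β-free (Fin.fromℕ< (s≤s k≤N) ,
              subst (λ l → β (path l) ≈ path l) (sym (Finₚ.toℕ-fromℕ< (s≤s k≤N))) f))
            d d≤N)
      where
      d≤N : d ≤ N
      d≤N = ℕₚ.≤-trans (ℕₚ.m≤n+m d (toℕ i))
              (ℕₚ.≤-pred (ℕₚ.≤-trans (ℕₚ.≤-reflexive i+d≡j) (ℕₚ.<⇒≤ (Finₚ.toℕ<n j))))

-- Finite functions, extremal elements, and involutions obtained from relations.

injective⇒surjective : ∀ {n} {f : Fin n → Fin n} → Injective _≡_ _≡_ f →
                       ∀ y → ∃[ x ] f x ≡ y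
injective⇒surjective {suc n} {f} f-inj y with Finₚ.any? (λ x → f x Fin.≟ y)
... | yes hit  = hit
... | no  miss = contradiction (Finₚ.injective⇒≤ (f-inj ∘ Finₚ.punchOut-injective (avoid _) (avoid _)))
                               ℕₚ.1+n≰n
  where
  avoid : ∀ x → y ≢ f x
  avoid x e = miss (x , sym e)

funToFin-cong : ∀ {m n} {f g : Fin m → Fin n} → f ≗ g → funToFin f ≡ funToFin g
funToFin-cong {zero}  f≗g = refl
funToFin-cong {suc m} f≗g = cong₂ combine (f≗g zero) (funToFin-cong (f≗g ∘ suc))

funToFin-injective : ∀ {m n} {f g : Fin m → Fin n} → funToFin f ≡ funToFin g → f ≗ g
funToFin-injective {f = f} {g} e i =
  trans (sym (Finₚ.finToFun-funToFin f i))
        (trans (cong (λ c → finToFun c i) e) (Finₚ.finToFun-funToFin g i))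

module _ {A : Set} {_≼_ : Rel A 0ℓ} (total : Total _≼_) (≼-trans : Transitive _≼_) where

  -- The order is a parameter so that flipping it yields greatest elements.
  least : ∀ {n} {P : Pred (Fin n) 0ℓ} → Decidable P → (g : Fin n → A) → ∃ P →
          ∃[ i ] P i × (∀ j → P j → g i ≼ g j)
  least {suc n} {P} P? g (k , Pk) with P? zero | Finₚ.any? (P? ∘ suc)
  ... | yes P0 | no ¬Ps = zero , P0 , λ
        { zero _ → [ id , id ]′ (total (g zero) (g zero))
        ; (suc j) Pj → contradiction (j , Pj) ¬Ps }
  ... | no ¬P0 | no ¬Ps with k
  ...   | zero  = contradiction Pk ¬P0
  ...   | suc j = contradiction (j , Pk) ¬Ps
  least {suc n} {P} P? g _ | no ¬P0 | yes Ps
    with i , Pi , min ← least (P? ∘ suc) (g ∘ suc) Ps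
    = suc i , Pi , λ { zero P0 → contradiction P0 ¬P0 ; (suc j) → min j }
  least {suc n} {P} P? g _ | yes P0 | yes Ps
    with i , Pi , min ← least (P? ∘ suc) (g ∘ suc) Ps
    with total (g zero) (g (suc i))
  ... | inj₁ 0≼i = zero , P0 , λ
        { zero _ → [ id , id ]′ (total (g zero) (g zero))
        ; (suc j) Pj → ≼-trans 0≼i (min j Pj) }
  ... | inj₂ i≼0 = suc i , Pi , λ { zero _ → i≼0 ; (suc j) → min j }

module _ {A : Set} {N : ℕ} (code : A → Fin N) {R : Rel A 0ℓ}
  (R-sym : ∀ {x y} → R x y → R y x)
  (R-resp : ∀ {x x′ y} → code x ≡ code x′ → R x y → R x′ y)
  (R-det : ∀ {x y y′} → R x y → R x y′ → code y ≡ code y′)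
  (f : A → A) (f∈R : ∀ x → R x (f x)) where

  -- The two pairings of flags are symmetric single-valued relations. A function inside such a
  -- relation is an involution, however its values were found.
  graph-cong : ∀ {x y} → code x ≡ code y → code (f x) ≡ code (f y)
  graph-cong {x} {y} e = R-det (R-resp e (f∈R x)) (f∈R y)

  graph-involutive : ∀ x → code (f (f x)) ≡ code x
  graph-involutive x = R-det (f∈R (f x)) (R-sym (f∈R x))

-- Rooms and their completion from a facet.

module Pivoting {n k : ℕ}
  (r : Fin (suc n) → Fin k → ℕ) (r-injective : ∀ i {x y} → r i x ≡ r i y → x ≡ y)
  (s : Fin (suc n) → Fin k) (φ : Fin k → Fin (suc n)) (φ∘s : ∀ i → φ (s i) ≡ i)
  (s-least : ∀ i x → r i (s i) ≤ r i x)
  (s-greatest : ∀ {i j} x → s (φ x) ≢ x → i ≢ j → r i x < r i (s j))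
  where

  s-injective : ∀ {i j} → s i ≡ s j → i ≡ j
  s-injective {i} {j} e = trans (sym (φ∘s i)) (trans (cong φ e) (φ∘s j))

  s-strictly-least : ∀ {i} x → x ≢ s i → r i (s i) < r i x
  s-strictly-least {i} x x≢s = ℕₚ.≤∧≢⇒< (s-least i x) (x≢s ∘ sym ∘ r-injective i)

  -- t i is the i-minimum of the set { t j }, which thereby has one element per row.
  record Room (t : Fin (suc n) → Fin k) : Set where
    field
      minimal    : ∀ {i j} → i ≢ j → r i (t i) < r i (t j)
      dominating : ∀ x → ∃[ i ] r i x ≤ r i (t i)

    minimal-≤ : ∀ i j → r i (t i) ≤ r i (t j)
    minimal-≤ i j with i Fin.≟ j
    ... | yes refl = ℕₚ.≤-refl
    ... | no  i≢j  = ℕₚ.<⇒≤ (minimal i≢j)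

    injective : ∀ {i j} → t i ≡ t j → i ≡ j
    injective {i} {j} e = decidable-stable (i Fin.≟ j) λ i≢j →
      ℕₚ.<-irrefl (cong (r i) e) (minimal i≢j)

  open Room

  -- Domination in `t` puts `t′ d` at or below the minimum of some row. This is row `d`, because any
  -- other row shares its minimum with `t′`, strictly below `t′ d`. By symmetry the entries in row
  -- `d` have equal rank.
  room-unique : ∀ {t t′} → Room t → Room t′ → ∀ d → (∀ j → j ≢ d → t j ≡ t′ j) → t ≗ t′
  room-unique {t} {t′} T T′ d agree j with j Fin.≟ d
  ... | no  j≢d  = agree j j≢d
  ... | yes refl = r-injective d (ℕₚ.≤-antisym
                     (bound T′ T (λ j j≢d → sym (agree j j≢d))) (bound T T′ agree))
    where
    bound : ∀ {t t′} → Room t → Room t′ → (∀ j → j ≢ d → t j ≡ t′ j) → r d (t′ d) ≤ r d (t d)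
    bound {t} {t′} T T′ agree with dominating T (t′ d)
    ... | l , le with l Fin.≟ d
    ...   | yes refl = le
    ...   | no  l≢d  = contradiction (minimal T′ l≢d)
                         (ℕₚ.≤⇒≯ (subst (λ y → r l (t′ d) ≤ r l y) (agree l l≢d) le))

  module _ (u : Fin (suc n) → Fin k) (d : Fin (suc n)) where

    Above : Fin k → Set
    Above x = ∀ j → j ≢ d → r j (u j) < r j x

    above? : Decidable Above
    above? x = Finₚ.all? (λ j → ¬? (j Fin.≟ d) →-dec (r j (u j) ℕₚ.<? r j x))

    -- Row `d` receives its greatest candidate `c` from `Above`. Elements of `Above` are then
    -- dominated in row `d`, all others in an old row, and `below` makes `c` the minimum of its row.
    complete : ∃ Above → (∀ x → Above x → ∀ j → j ≢ d → r d x < r d (u j)) →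
               (∀ i j → i ≢ d → j ≢ d → i ≢ j → r i (u i) < r i (u j)) →
               ∃[ t ] Room t × (∀ j → j ≢ d → t j ≡ u j)
    complete nonempty below u-minimal
      with c , c-above , c-greatest ← least (flip ℕₚ.≤-total) (flip ℕₚ.≤-trans) above? (r d) nonempty
      = t , record { minimal = t-minimal ; dominating = t-dominating } , t-off
      where
      t = updateAt u d (λ _ → c)
      t-at : t d ≡ c
      t-at = updateAt-updates d u
      t-off : ∀ j → j ≢ d → t j ≡ u j
      t-off j = updateAt-minimal j d u

      t-minimal : ∀ {i j} → i ≢ j → r i (t i) < r i (t j)
      t-minimal {i} {j} i≢j with i Fin.≟ d | j Fin.≟ d
      ... | yes refl | yes refl = contradiction refl i≢j
      ... | yes refl | no j≢d rewrite t-at | t-off j j≢d = below c c-above j j≢d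
      ... | no i≢d | yes refl rewrite t-at | t-off i i≢d = c-above i i≢d
      ... | no i≢d | no j≢d rewrite t-off i i≢d | t-off j j≢d = u-minimal i j i≢d j≢d i≢j

      t-dominating : ∀ x → ∃[ i ] r i x ≤ r i (t i)
      t-dominating x with Finₚ.any? (λ j → ¬? (j Fin.≟ d) ×-dec (r j x ℕₚ.≤? r j (u j)))
      ... | yes (j , j≢d , le) = j , subst (λ y → r j x ≤ r j y) (sym (t-off j j≢d)) le
      ... | no  none = d , subst (λ y → r d x ≤ r d y) (sym t-at)
              (c-greatest x λ j j≢d → ℕₚ.≰⇒> λ le → none (j , j≢d , le))

  -- Flags, and those with a facet of slacks.

  -- A room together with one of its elements t door; removing that element leaves
  -- a facet carrying all labels but zero.
  record Flag : Set where
    field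
      t        : Fin (suc n) → Fin k
      door     : Fin (suc n)
      room     : Room t
      labelled : ∀ i → i ≢ zero → ∃[ b ] b ≢ door × φ (t b) ≡ i

  open Flag

  code : Flag → Fin (k ^ suc n * suc n)
  code x = combine (funToFin (t x)) (door x)

  infix 4 _≈_
  _≈_ : Flag → Flag → Set
  _≈_ = _≡_ on code

  ≈-intro : ∀ {x y} → t x ≗ t y → door x ≡ door y → x ≈ y
  ≈-intro t≗ d≡ = cong₂ combine (funToFin-cong t≗) d≡

  ≈-room : ∀ {x y} → x ≈ y → t x ≗ t y
  ≈-room {x} {y} e = funToFin-injective {f = t x} {t y}
    (Finₚ.combine-injectiveˡ (funToFin (t x)) (door x) (funToFin (t y)) (door y) e)

  ≈-door : ∀ {x y} → x ≈ y → door x ≡ door y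
  ≈-door {x} {y} = Finₚ.combine-injectiveʳ (funToFin (t x)) (door x) (funToFin (t y)) (door y)

  -- As `φ` is a left inverse of `s`, the equation says that `t x b` is a slack.
  AllSlack : Flag → Set
  AllSlack x = ∀ b → b ≢ door x → s (φ (t x b)) ≡ t x b

  AllSlack-resp : ∀ {x y} → x ≈ y → AllSlack x → AllSlack y
  AllSlack-resp {x} {y} e slack b b≢ =
    subst (λ z → s (φ z) ≡ z) (≈-room {x} {y} e b) (slack b (b≢ ∘ λ b≡ → trans b≡ (≈-door {x} {y} e)))

  -- s j is on the facet, and only row j can have s j as its minimum.
  allSlack⇒canonical : ∀ x → AllSlack x → ∀ j → j ≢ zero → t x j ≡ s j × j ≢ door x
  allSlack⇒canonical x slack j j≢0
    with b , b≢ , φb ← labelled x j j≢0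
    with tb ← trans (sym (slack b b≢)) (cong s φb)
    with j Fin.≟ b
  ... | yes refl = tb , b≢
  ... | no j≢b = contradiction (minimal (room x) j≢b)
                   (ℕₚ.≤⇒≯ (subst (λ y → r j y ≤ r j (t x j)) (sym tb) (s-least j (t x j))))

  allSlack⇒door : ∀ x → AllSlack x → door x ≡ zero
  allSlack⇒door x slack = decidable-stable (door x Fin.≟ zero) λ d≢0 →
    proj₂ (allSlack⇒canonical x slack (door x) d≢0) refl

  allSlack-unique : ∀ {x y} → AllSlack x → AllSlack y → x ≈ y
  allSlack-unique {x} {y} X Y = ≈-intro {x} {y}
    (room-unique (room x) (room y) zero λ j j≢0 →
      trans (proj₁ (allSlack⇒canonical x X j j≢0)) (sym (proj₁ (allSlack⇒canonical y Y j j≢0))))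
    (trans (allSlack⇒door x X) (sym (allSlack⇒door y Y)))

  opaque
    -- Row zero is filled over the slacks of the other rows. The candidates are `s zero` and
    -- contracts, all below those slacks in row zero.
    start : ∃ AllSlack
    start with complete s zero (s zero , above₀) below s-minimal
      where
      s-minimal : ∀ i j → i ≢ zero → j ≢ zero → i ≢ j → r i (s i) < r i (s j)
      s-minimal i j _ _ i≢j = s-strictly-least (s j) (i≢j ∘ sym ∘ s-injective)

      above₀ : Above s zero (s zero)
      above₀ j j≢0 = s-strictly-least (s zero) (j≢0 ∘ sym ∘ s-injective)

      below : ∀ x → Above s zero x → ∀ j → j ≢ zero → r zero x < r zero (s j)
      below x x-above j j≢0 with s (φ x) Fin.≟ x
      ... | no contract = s-greatest x contract (j≢0 ∘ sym)
      ... | yes slack with φ x Fin.≟ zero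
      ...   | yes φx≡0 = subst (λ y → r zero y < r zero (s j)) (trans (cong s (sym φx≡0)) slack)
                           (s-strictly-least (s j) (j≢0 ∘ s-injective))
      ...   | no  φx≢0 = contradiction (x-above (φ x) φx≢0) (ℕₚ.<-irrefl (cong (r (φ x)) slack))
    ... | t₀ , T₀ , t₀-off = record
          { t = t₀ ; door = zero ; room = T₀
          ; labelled = λ i i≢0 → i , i≢0 , trans (cong φ (t₀-off i i≢0)) (φ∘s i) }
        , λ b b≢0 → trans (cong s (trans (cong φ (t₀-off b b≢0)) (φ∘s b))) (sym (t₀-off b b≢0))

  -- Pivoting across a facet.

  -- The two flags have the same facet.  Its minimum in row door x is also its
  -- minimum in row door y: each room resolves this clash by its new element.
  record Pivot (x y : Flag) : Set where
    field
      doors-differ : door x ≢ door y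
      moved        : t y (door x) ≡ t x (door y)
      kept         : ∀ j → j ≢ door x → j ≢ door y → t y j ≡ t x j

  open Pivot

  pivot-sym : ∀ {x y} → Pivot x y → Pivot y x
  pivot-sym p = record
    { doors-differ = doors-differ p ∘ sym
    ; moved = sym (moved p)
    ; kept = λ j j≢y j≢x → sym (kept p j j≢x j≢y) }

  pivot-resp : ∀ {x x′ y} → x ≈ x′ → Pivot x y → Pivot x′ y
  pivot-resp {x} {x′} {y} e p = record
    { doors-differ = doors-differ p ∘ trans d
    ; moved = trans (cong (t y) (sym d)) (trans (moved p) (t≗ (door y)))
    ; kept = λ j j≢x j≢y → trans (kept p j (j≢x ∘ λ j≡ → trans j≡ d) j≢y) (t≗ j) }
    where
    d = ≈-door {x} {x′} e
    t≗ = ≈-room {x} {x′} e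

  -- The element moved into row `door x` is the minimum of the facet there, which determines the new
  -- door; `room-unique` determines the rest.
  pivot-det : ∀ {x y y′} → Pivot x y → Pivot x y′ → y ≈ y′
  pivot-det {x} {y} {y′} p p′ =
    ≈-intro {y} {y′} (room-unique (room y) (room y′) (door y) agree) doors≡
    where
    less : ∀ {y y′} → Pivot x y → Pivot x y′ → door y ≢ door y′ →
           r (door x) (t x (door y)) < r (door x) (t x (door y′))
    less {y} {y′} p p′ d≢ = subst₂ (λ a b → r (door x) a < r (door x) b)
      (moved p) (kept p (door y′) (doors-differ p′ ∘ sym) (d≢ ∘ sym))
      (minimal (room y) (doors-differ p′))

    doors≡ : door y ≡ door y′
    doors≡ = decidable-stable (door y Fin.≟ door y′) λ d≢ →
      ℕₚ.<-asym (less p p′ d≢) (less p′ p (d≢ ∘ sym))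

    agree : ∀ j → j ≢ door y → t y j ≡ t y′ j
    agree j j≢y with j Fin.≟ door x
    ... | yes refl = trans (moved p) (trans (cong (t x) doors≡) (sym (moved p′)))
    ... | no  j≢x  = trans (kept p j j≢x j≢y)
                       (sym (kept p′ j j≢x (j≢y ∘ λ j≡ → trans j≡ (sym doors≡))))

  -- The new element `z` of `y` would lie above `s i₁` in row zero. No contract does, `s zero` is
  -- least there, and every other slack except `s i₁` itself is already in the facet.
  allSlack⇒¬pivot : ∀ {x y} → AllSlack x → ¬ Pivot x y
  allSlack⇒¬pivot {x} {y} slack p = z-not-slack (decidable-stable (s (φ z) Fin.≟ z) z-slack)
    where
    i₁ = door y
    z = t y i₁
    door≡0 = allSlack⇒door x slack
    0≢i₁ : zero ≢ i₁
    0≢i₁ = doors-differ p ∘ trans door≡0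
    si₁<z : r zero (s i₁) < r zero z
    si₁<z = subst (λ w → r zero w < r zero z)
      (trans (cong (t y) (sym door≡0)) (trans (moved p) (proj₁ (allSlack⇒canonical x slack i₁ (0≢i₁ ∘ sym)))))
      (minimal (room y) 0≢i₁)
    z-slack : ¬ s (φ z) ≢ z
    z-slack contract = ℕₚ.<-asym si₁<z (s-greatest z contract 0≢i₁)
    z-not-slack : s (φ z) ≢ z
    z-not-slack e with φ z Fin.≟ zero | φ z Fin.≟ i₁
    ... | yes φz≡0 | _ = ℕₚ.<⇒≱ si₁<z
          (subst (λ w → r zero w ≤ r zero (s i₁)) (trans (cong s (sym φz≡0)) e) (s-least zero (s i₁)))
    ... | no _ | yes φz≡i₁ = ℕₚ.<-irrefl (cong (r zero) (trans (cong s (sym φz≡i₁)) e)) si₁<z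
    ... | no φz≢0 | no φz≢i₁ = φz≢i₁ (injective (room y)
          (trans (kept p (φ z) (λ φz≡ → φz≢0 (trans φz≡ door≡0)) φz≢i₁)
                 (trans (proj₁ (allSlack⇒canonical x slack (φ z) φz≢0)) e)))

  -- Dropping `t x i₀` leaves row `i₀` empty. The minimum `t x i₁` of the facet in that row moves
  -- there, and the vacated row `i₁` is completed anew.
  pivot : ∀ x → ∃[ b ] (b ≢ door x × s (φ (t x b)) ≢ t x b) → ∃ (Pivot x)
  pivot x (b , b≢i₀ , b-contract)
    with i₁ , i₁≢i₀ , i₁-least ← least ℕₚ.≤-total ℕₚ.≤-trans (λ j → ¬? (j Fin.≟ door x))
                                   (r (door x) ∘ t x) (b , b≢i₀)
    = result
    where
    i₀ = door x
    T = room x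
    u = updateAt (t x) i₀ (λ _ → t x i₁)
    u-at : u i₀ ≡ t x i₁
    u-at = updateAt-updates i₀ (t x)
    u-off : ∀ j → j ≢ i₀ → u j ≡ t x j
    u-off j = updateAt-minimal j i₀ (t x)

    -- Here the contract on the facet is needed: in each row other than `i₁` it lies between the row
    -- minimum and `s i₁`.
    above₁ : Above u i₁ (s i₁)
    above₁ j j≢i₁ with j Fin.≟ i₀
    ... | yes refl rewrite u-at =
          ℕₚ.≤-<-trans (i₁-least b b≢i₀) (s-greatest (t x b) b-contract j≢i₁)
    ... | no j≢i₀ rewrite u-off j j≢i₀ =
          ℕₚ.≤-<-trans (minimal-≤ T j b) (s-greatest (t x b) b-contract j≢i₁)

    -- The old room dominates `c` in some row. A candidate exceeds the old minimum in every row but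
    -- `i₁`, so this row is `i₁`.
    below-t : ∀ c → Above u i₁ c → r i₁ c < r i₁ (t x i₁)
    below-t c above = ℕₚ.≤∧≢⇒< c≤ λ e → ℕₚ.<-irrefl (cong (r i₀) (sym (r-injective i₁ e))) above₀
      where
      above₀ : r i₀ (t x i₁) < r i₀ c
      above₀ = subst (λ w → r i₀ w < r i₀ c) u-at (above i₀ (i₁≢i₀ ∘ sym))
      c≤ : r i₁ c ≤ r i₁ (t x i₁)
      c≤ with dominating T c
      ... | l , le with l Fin.≟ i₁ | l Fin.≟ i₀
      ...   | yes refl | _ = le
      ...   | no _ | yes refl = contradiction (ℕₚ.<-trans (minimal T (i₁≢i₀ ∘ sym)) above₀) (ℕₚ.≤⇒≯ le)
      ...   | no l≢i₁ | no l≢i₀ = contradiction (above l l≢i₁)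
                (ℕₚ.≤⇒≯ (subst (λ w → r l c ≤ r l w) (sym (u-off l l≢i₀)) le))

    below : ∀ c → Above u i₁ c → ∀ j → j ≢ i₁ → r i₁ c < r i₁ (u j)
    below c above j j≢i₁ with j Fin.≟ i₀
    ... | yes refl rewrite u-at = below-t c above
    ... | no j≢i₀ rewrite u-off j j≢i₀ = ℕₚ.<-trans (below-t c above) (minimal T (j≢i₁ ∘ sym))

    u-minimal : ∀ i j → i ≢ i₁ → j ≢ i₁ → i ≢ j → r i (u i) < r i (u j)
    u-minimal i j i≢i₁ j≢i₁ i≢j with i Fin.≟ i₀ | j Fin.≟ i₀
    ... | yes refl | yes refl = contradiction refl i≢j
    ... | yes refl | no j≢i₀ rewrite u-at | u-off j j≢i₀ =
          ℕₚ.≤∧≢⇒< (i₁-least j j≢i₀) (j≢i₁ ∘ sym ∘ injective T ∘ r-injective i₀)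
    ... | no i≢i₀ | yes refl rewrite u-at | u-off i i≢i₀ = minimal T i≢i₁
    ... | no i≢i₀ | no j≢i₀ rewrite u-off i i≢i₀ | u-off j j≢i₀ = minimal T i≢j

    result : ∃ (Pivot x)
    result with complete u i₁ (s i₁ , above₁) below u-minimal
    ... | t′ , T′ , t′-off = y , record
      { doors-differ = i₁≢i₀ ∘ sym
      ; moved = t′-moved
      ; kept = t′-kept }
      where
      t′-moved : t′ i₀ ≡ t x i₁
      t′-moved = trans (t′-off i₀ (i₁≢i₀ ∘ sym)) u-at
      t′-kept : ∀ j → j ≢ i₀ → j ≢ i₁ → t′ j ≡ t x j
      t′-kept j j≢i₀ j≢i₁ = trans (t′-off j j≢i₁) (u-off j j≢i₀)
      labelled′ : ∀ i → i ≢ zero → ∃[ b ] b ≢ i₁ × φ (t′ b) ≡ i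
      labelled′ i i≢0 with labelled x i i≢0
      ... | b , b≢i₀ , φb with b Fin.≟ i₁
      ...   | yes refl = i₀ , i₁≢i₀ ∘ sym , trans (cong φ t′-moved) φb
      ...   | no b≢i₁  = b , b≢i₁ , trans (cong φ (t′-kept b b≢i₀ b≢i₁)) φb
      y : Flag
      y = record { t = t′ ; door = i₁ ; room = T′ ; labelled = labelled′ }

  -- The facet of slacks lies on the boundary, with a room on one side only, so its flag is paired
  -- with itself.
  Across : Rel Flag 0ℓ
  Across x y = Pivot x y ⊎ (x ≈ y × AllSlack x)

  opaque
    across : ∀ x → ∃ (Across x)
    across x with Finₚ.any? (λ b → ¬? (b Fin.≟ door x) ×-dec ¬? (s (φ (t x b)) Fin.≟ t x b))
    ... | yes contract with y , p ← pivot x contract = y , inj₁ p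
    ... | no  none = x , inj₂ (refl , λ b b≢ → decidable-stable (_ Fin.≟ _) λ ≢ → none (b , b≢ , ≢))

  across-sym : ∀ {x y} → Across x y → Across y x
  across-sym (inj₁ p) = inj₁ (pivot-sym p)
  across-sym {x} {y} (inj₂ (e , slack)) = inj₂ (sym e , AllSlack-resp {x} {y} e slack)

  across-resp : ∀ {x x′ y} → x ≈ x′ → Across x y → Across x′ y
  across-resp e (inj₁ p) = inj₁ (pivot-resp e p)
  across-resp {x} {x′} e (inj₂ (e′ , slack)) = inj₂ (trans (sym e) e′ , AllSlack-resp {x} {x′} e slack)

  across-det : ∀ {x y y′} → Across x y → Across x y′ → y ≈ y′
  across-det (inj₁ p) (inj₁ p′) = pivot-det p p′
  across-det (inj₁ p) (inj₂ (_ , slack)) = contradiction p (allSlack⇒¬pivot slack)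
  across-det (inj₂ (_ , slack)) (inj₁ p) = contradiction p (allSlack⇒¬pivot slack)
  across-det (inj₂ (e , _)) (inj₂ (e′ , _)) = trans (sym e) e′

  -- Exchanging doors inside a room.

  label-off-door : ∀ x b → b ≢ door x →
    ∃[ a ] φ (t x b) ≡ suc a × proj₁ (labelled x (suc a) λ ()) ≡ b
  label-off-door x b b≢ with injective⇒surjective g-injective b
    where
    -- Being injective on a finite set, `g` is onto, so the positions off the door carry each
    -- nonzero label exactly once.
    g : Fin (suc n) → Fin (suc n)
    g zero    = door x
    g (suc i) = proj₁ (labelled x (suc i) λ ())
    g-injective : Injective _≡_ _≡_ g
    g-injective {zero}  {zero}  _ = refl
    g-injective {zero}  {suc j} e = contradiction (sym e) (proj₁ (proj₂ (labelled x (suc j) λ ())))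
    g-injective {suc i} {zero}  e = contradiction e (proj₁ (proj₂ (labelled x (suc i) λ ())))
    g-injective {suc i} {suc j} e = trans (sym (proj₂ (proj₂ (labelled x (suc i) λ ()))))
      (trans (cong (φ ∘ t x) e) (proj₂ (proj₂ (labelled x (suc j) λ ()))))
  ... | zero  , e    = contradiction (sym e) b≢
  ... | suc a , e    = a , trans (cong (φ ∘ t x) (sym e)) (proj₂ (proj₂ (labelled x (suc a) λ ()))) , e

  label-nonzero : ∀ x {b} → b ≢ door x → φ (t x b) ≢ zero
  label-nonzero x {b} b≢ e with label-off-door x b b≢
  ... | a , φb , _ = Finₚ.0≢1+n (trans (sym e) φb)

  label-injective : ∀ x {b c} → b ≢ door x → c ≢ door x → φ (t x b) ≡ φ (t x c) → b ≡ c
  label-injective x {b} {c} b≢ c≢ e with label-off-door x b b≢ | label-off-door x c c≢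
  ... | a , φb , ga | a′ , φc , ga′ with refl ← Finₚ.suc-injective (trans (sym φb) (trans e φc))
      = trans (sym ga) ga′

  -- A nonzero label at the door recurs at exactly one other position, the only other possible door.
  -- Label zero there means that the room is fully labelled, and the flag is paired with itself.
  record Within (x y : Flag) : Set where
    field
      same-room : t x ≗ t y
      doors     : (door x ≢ door y × φ (t x (door x)) ≡ φ (t x (door y)))
                ⊎ (door x ≡ door y × φ (t x (door x)) ≡ zero)

  open Within

  opaque
    within : ∀ x → ∃ (Within x)
    within x with φ (t x (door x)) Fin.≟ zero
    ... | yes φ≡0 = x , record { same-room = λ _ → refl ; doors = inj₂ (refl , φ≡0) }
    ... | no  φ≢0 with labelled x _ φ≢0
    ...   | d , d≢ , φd = record { t = t x ; door = d ; room = room x ; labelled = labelled′ }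
                        , record { same-room = λ _ → refl ; doors = inj₁ (d≢ ∘ sym , sym φd) }
      where
      labelled′ : ∀ i → i ≢ zero → ∃[ b ] b ≢ d × φ (t x b) ≡ i
      labelled′ i i≢0 with labelled x i i≢0
      ... | b , b≢ , φb with b Fin.≟ d
      ...   | yes refl = door x , d≢ ∘ sym , trans (sym φd) φb
      ...   | no  b≢d  = b , b≢d , φb

  within-sym : ∀ {x y} → Within x y → Within y x
  within-sym {x} {y} w = record { same-room = sym ∘ same-room w ; doors = doors′ (doors w) }
    where
    doors′ : _ → _
    doors′ (inj₁ (d≢ , e)) = inj₁ (d≢ ∘ sym ,
      trans (cong φ (sym (same-room w _))) (trans (sym e) (cong φ (same-room w _))))
    doors′ (inj₂ (d≡ , e)) = inj₂ (sym d≡ ,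
      trans (cong φ (sym (same-room w _))) (trans (cong (φ ∘ t x) (sym d≡)) e))

  within-resp : ∀ {x x′ y} → x ≈ x′ → Within x y → Within x′ y
  within-resp {x} {x′} {y} e w = record
    { same-room = λ j → trans (sym (t≗ j)) (same-room w j) ; doors = doors′ (doors w) }
    where
    d = ≈-door {x} {x′} e
    t≗ = ≈-room {x} {x′} e
    at-door : φ (t x′ (door x′)) ≡ φ (t x (door x))
    at-door = cong φ (trans (cong (t x′) (sym d)) (sym (t≗ (door x))))
    doors′ : _ → _
    doors′ (inj₁ (d≢ , e)) = inj₁ (d≢ ∘ trans d , trans at-door (trans e (cong φ (t≗ (door y)))))
    doors′ (inj₂ (d≡ , e)) = inj₂ (trans (sym d) d≡ , trans at-door e)

  within-det : ∀ {x y y′} → Within x y → Within x y′ → y ≈ y′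
  within-det {x} {y} {y′} w w′ = ≈-intro {y} {y′}
    (λ j → trans (sym (same-room w j)) (same-room w′ j)) (doors≡ (doors w) (doors w′))
    where
    doors≡ : _ → _ → door y ≡ door y′
    doors≡ (inj₁ (d≢ , e)) (inj₁ (d≢′ , e′)) =
      label-injective x (d≢ ∘ sym) (d≢′ ∘ sym) (trans (sym e) e′)
    doors≡ (inj₁ (d≢ , e)) (inj₂ (_ , e′)) = contradiction (trans (sym e) e′) (label-nonzero x (d≢ ∘ sym))
    doors≡ (inj₂ (_ , e)) (inj₁ (d≢ , e′)) = contradiction (trans (sym e′) e) (label-nonzero x (d≢ ∘ sym))
    doors≡ (inj₂ (d≡ , _)) (inj₂ (d≡′ , _)) = trans (sym d≡) d≡′

  -- Existence of a fully labelled room.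

  α β : Flag → Flag
  α = proj₁ ∘ across
  β = proj₁ ∘ within

  α-across : ∀ x → Across x (α x)
  α-across = proj₂ ∘ across

  β-within : ∀ x → Within x (β x)
  β-within = proj₂ ∘ within

  x₀ : Flag
  x₀ = proj₁ start

  α-fixed : α x₀ ≈ x₀
  α-fixed = across-det {x₀} {α x₀} {x₀} (α-across x₀) (inj₂ (refl , proj₂ start))

  α-fixed-unique : ∀ {x} → α x ≈ x → x ≈ x₀
  α-fixed-unique {x} e with α-across x
  ... | inj₁ p = contradiction (sym (≈-door {α x} {x} e)) (doors-differ p)
  ... | inj₂ (_ , slack) = allSlack-unique {x} {x₀} slack (proj₂ start)

  opaque
    fullyLabelledRoom : ∃[ t ] Room t × (∀ i → ∃[ b ] φ (t b) ≡ i)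
    fullyLabelledRoom with Involutions.involution-fixed code α β x₀
        (graph-cong code across-sym across-resp across-det α α-across)
        (graph-involutive code across-sym across-resp across-det α α-across)
        (graph-cong code within-sym within-resp within-det β β-within)
        (graph-involutive code within-sym within-resp within-det β β-within)
        α-fixed α-fixed-unique
    ... | x , e with doors (β-within x)
    ...   | inj₁ (d≢ , _) = contradiction (sym (≈-door {β x} {x} e)) d≢
    ...   | inj₂ (_ , φ≡0) = t x , room x , λ
            { zero → door x , φ≡0
            ; (suc i) → let b , _ , φb = labelled x (suc i) λ () in b , φb }

-- Pairwise rejection as a strict partial order.

module PairwiseChoice {m : ℕ} {X : Subset m} {f : Subset m → Subset m}
  (choice : IsChoiceFunction X f) (plott : IsPlott X f) (nonEmpty : IsNonEmptyValued X f)
  where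

  Rejected : Fin m → Fin m → Set
  Rejected x y = x ∉ f (⁅ x ⁆ ∪ ⁅ y ⁆)

  singleton⊆ : ∀ {x} → x ∈ X → ⁅ x ⁆ ⊆ X
  singleton⊆ {x} x∈X z∈ = subst (_∈ X) (sym (x∈⁅y⁆⇒x≡y x z∈)) x∈X

  pair⊆ : ∀ {x y} → x ∈ X → y ∈ X → ⁅ x ⁆ ∪ ⁅ y ⁆ ⊆ X
  pair⊆ {x} {y} x∈X y∈X z∈ with x∈p∪q⁻ ⁅ x ⁆ ⁅ y ⁆ z∈
  ... | inj₁ z∈x = singleton⊆ x∈X z∈x
  ... | inj₂ z∈y = singleton⊆ y∈X z∈y

  rejected⇒other : ∀ {x y} → x ∈ X → y ∈ X → Rejected x y → f (⁅ x ⁆ ∪ ⁅ y ⁆) ≡ ⁅ y ⁆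
  rejected⇒other {x} {y} x∈X y∈X x∉ = ⊆-antisym only-y y-chosen
    where
    is-y : ∀ {z} → z ∈ f (⁅ x ⁆ ∪ ⁅ y ⁆) → z ≡ y
    is-y z∈ with x∈p∪q⁻ ⁅ x ⁆ ⁅ y ⁆ (choice _ (pair⊆ x∈X y∈X) z∈)
    ... | inj₁ z∈x with refl ← x∈⁅y⁆⇒x≡y x z∈x = contradiction z∈ x∉
    ... | inj₂ z∈y = x∈⁅y⁆⇒x≡y y z∈y
    only-y : f (⁅ x ⁆ ∪ ⁅ y ⁆) ⊆ ⁅ y ⁆
    only-y z∈ = subst (_∈ ⁅ y ⁆) (sym (is-y z∈)) (x∈⁅x⁆ y)
    y-chosen : ⁅ y ⁆ ⊆ f (⁅ x ⁆ ∪ ⁅ y ⁆)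
    y-chosen w∈ with refl ← x∈⁅y⁆⇒x≡y y w∈ with nonempty? (f (⁅ x ⁆ ∪ ⁅ y ⁆))
    ... | yes (z , z∈) = subst (_∈ f (⁅ x ⁆ ∪ ⁅ y ⁆)) (is-y z∈) z∈
    ... | no  empty    = contradiction (Empty-unique empty) (nonEmpty _ (pair⊆ x∈X y∈X)
            λ e → ∉⊥ (subst (x ∈_) e (x∈p∪q⁺ (inj₁ (x∈⁅x⁆ x)))))

  rejected-asym : ∀ {x y} → x ∈ X → y ∈ X → Rejected x y → ¬ Rejected y x
  rejected-asym {x} {y} x∈X y∈X x∉ y∉ = y∉ (subst (y ∈_)
    (trans (sym (rejected⇒other x∈X y∈X x∉)) (cong f (∪-comm ⁅ x ⁆ ⁅ y ⁆))) (x∈⁅x⁆ y))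

  -- By Plott, the choice from the triple reduces both to the choice from `x`, `z` and to that from
  -- `y`, `z`, which is `z` alone. So `x` could be chosen only if `x ≡ z`, against asymmetry.
  rejected-trans : ∀ {x y z} → x ∈ X → y ∈ X → z ∈ X → Rejected x y → Rejected y z → Rejected x z
  rejected-trans {x} {y} {z} x∈X y∈X z∈X x∉ y∉ x∈f =
    rejected-asym x∈X y∈X x∉ (subst (Rejected y) (sym x≡z) y∉)
    where
    fyz = rejected⇒other y∈X z∈X y∉
    fxz : f (⁅ x ⁆ ∪ ⁅ z ⁆) ≡ ⁅ z ⁆
    fxz = begin
      f (⁅ x ⁆ ∪ ⁅ z ⁆)                  ≡⟨ cong f (∪-comm ⁅ x ⁆ ⁅ z ⁆) ⟩
      f (⁅ z ⁆ ∪ ⁅ x ⁆)                  ≡⟨ cong (λ A → f (A ∪ ⁅ x ⁆)) fyz ⟨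
      f (f (⁅ y ⁆ ∪ ⁅ z ⁆) ∪ ⁅ x ⁆)      ≡⟨ plott _ _ (pair⊆ y∈X z∈X) (singleton⊆ x∈X) ⟨
      f ((⁅ y ⁆ ∪ ⁅ z ⁆) ∪ ⁅ x ⁆)        ≡⟨ cong f (∪-comm _ ⁅ x ⁆) ⟩
      f (⁅ x ⁆ ∪ (⁅ y ⁆ ∪ ⁅ z ⁆))        ≡⟨ cong f (∪-assoc ⁅ x ⁆ ⁅ y ⁆ ⁅ z ⁆) ⟨
      f ((⁅ x ⁆ ∪ ⁅ y ⁆) ∪ ⁅ z ⁆)        ≡⟨ plott _ _ (pair⊆ x∈X y∈X) (singleton⊆ z∈X) ⟩
      f (f (⁅ x ⁆ ∪ ⁅ y ⁆) ∪ ⁅ z ⁆)      ≡⟨ cong (λ A → f (A ∪ ⁅ z ⁆)) (rejected⇒other x∈X y∈X x∉) ⟩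
      f (⁅ y ⁆ ∪ ⁅ z ⁆)                  ≡⟨ fyz ⟩
      ⁅ z ⁆                              ∎
      where open ≡-Reasoning
    x≡z : x ≡ z
    x≡z = x∈⁅y⁆⇒x≡y z (subst (x ∈_) fxz x∈f)

-- Linear ranks with slack contracts.

comprehension : ∀ {m} {Q : Pred (Fin m) 0ℓ} → Decidable Q → Subset m
comprehension Q? = tabulate (does ∘ Q?)

∈-comprehension⁺ : ∀ {m} {Q : Pred (Fin m) 0ℓ} (Q? : Decidable Q) {x} → Q x → x ∈ comprehension Q?
∈-comprehension⁺ Q? {x} Qx =
  lookup⇒[]= x _ (trans (lookup∘tabulate (does ∘ Q?) x) (dec-true (Q? x) Qx))

∈-comprehension⁻ : ∀ {m} {Q : Pred (Fin m) 0ℓ} (Q? : Decidable Q) {x} → x ∈ comprehension Q? → Q x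
∈-comprehension⁻ Q? {x} x∈ with trans (sym (lookup∘tabulate (does ∘ Q?) x)) ([]=⇒lookup x∈)
... | e with Q? x
...   | yes Qx = Qx

lexicographic-< : ∀ {a b k x} y → a < b → x < k → a * k + x < b * k + y
lexicographic-< {a} {b} {k} {x} y a<b x<k = begin-strict
  a * k + x  <⟨ ℕₚ.+-monoʳ-< (a * k) x<k ⟩
  a * k + k  ≡⟨ ℕₚ.+-comm (a * k) k ⟩
  suc a * k  ≤⟨ ℕₚ.*-monoˡ-≤ k a<b ⟩
  b * k      ≤⟨ ℕₚ.m≤m+n (b * k) y ⟩
  b * k + y  ∎
  where open ℕₚ.≤-Reasoning

module MetaStability {n m : ℕ} (P : Fin m → Subset (suc n)) (participant : ∀ c → Nonempty (P c))
  (f : Fin (suc n) → Subset m → Subset m)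
  (choice : ∀ i → IsChoiceFunction (contractsOf P i) (f i))
  (plott : ∀ i → IsPlott (contractsOf P i) (f i))
  (nonEmpty : ∀ i → IsNonEmptyValued (contractsOf P i) (f i))
  where

  module Choice (i : Fin (suc n)) = PairwiseChoice (choice i) (plott i) (nonEmpty i)
  open Choice using (Rejected)

  contractsOf⁺ : ∀ {i c} → i ∈ P c → c ∈ contractsOf P i
  contractsOf⁺ {i} = ∈-comprehension⁺ (λ c → i ∈? P c)

  contractsOf⁻ : ∀ {i c} → c ∈ contractsOf P i → i ∈ P c
  contractsOf⁻ {i} = ∈-comprehension⁻ (λ c → i ∈? P c)

  below? : ∀ i d → Decidable (λ x → i ∈ P x × Rejected i x d)
  below? i d x = (i ∈? P x) ×-dec ¬? (x ∈? f i (⁅ x ⁆ ∪ ⁅ d ⁆))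

  below : Fin (suc n) → Fin m → Subset m
  below i d = comprehension (below? i d)

  -- Transitivity gives the inclusion of down-sets, and `a` itself makes it strict, so cardinality
  -- linearises the order up to ties.
  below-< : ∀ {i a d} → i ∈ P a → i ∈ P d → Rejected i a d → ∣ below i a ∣ < ∣ below i d ∣
  below-< {i} {a} {d} a∈ d∈ a∉ = p⊂q⇒∣p∣<∣q∣ (sub , a , a∈below-d , a∉below-a)
    where
    sub : below i a ⊆ below i d
    sub x∈ with x∈i , x∉ ← ∈-comprehension⁻ (below? i a) x∈ = ∈-comprehension⁺ (below? i d)
      (x∈i , Choice.rejected-trans i (contractsOf⁺ x∈i) (contractsOf⁺ a∈) (contractsOf⁺ d∈) x∉ a∉)
    a∈below-d : a ∈ below i d
    a∈below-d = ∈-comprehension⁺ (below? i d) (a∈ , a∉)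
    a∉below-a : a ∉ below i a
    a∉below-a a∈below with _ , rej ← ∈-comprehension⁻ (below? i a) a∈below =
      Choice.rejected-asym i (contractsOf⁺ a∈) (contractsOf⁺ a∈) rej rej

  k : ℕ
  k = suc n + m

  -- For agent `i` the values are 0 for the own slack, 1 to `1 + m` for own contracts, `2 + m` for
  -- contracts of others only, and `3 + m` for other slacks.
  level : Fin (suc n) → Fin (suc n) ⊎ Fin m → ℕ
  level i (inj₁ j) = if does (i Fin.≟ j) then 0 else 3 + m
  level i (inj₂ c) = if does (i ∈? P c) then suc ∣ below i c ∣ else 2 + m

  level-own-slack : ∀ i → level i (inj₁ i) ≡ 0
  level-own-slack i rewrite dec-true (i Fin.≟ i) refl = refl

  level-other-slack : ∀ {i j} → i ≢ j → level i (inj₁ j) ≡ 3 + m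
  level-other-slack {i} {j} i≢j rewrite dec-false (i Fin.≟ j) i≢j = refl

  level-member : ∀ {i c} → i ∈ P c → level i (inj₂ c) ≡ suc ∣ below i c ∣
  level-member {i} {c} i∈ rewrite dec-true (i ∈? P c) i∈ = refl

  level-nonmember : ∀ {i c} → i ∉ P c → level i (inj₂ c) ≡ 2 + m
  level-nonmember {i} {c} i∉ rewrite dec-false (i ∈? P c) i∉ = refl

  level-contract : ∀ i c → 0 < level i (inj₂ c) × level i (inj₂ c) < 3 + m
  level-contract i c with i ∈? P c
  ... | yes _ = s≤s z≤n , s≤s (s≤s (ℕₚ.m≤n⇒m≤1+n (∣p∣≤n (below i c))))
  ... | no  _ = s≤s z≤n , ℕₚ.≤-refl

  -- A two-digit number in base `k`, whose low digit breaks ties between equal levels.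
  rank : Fin (suc n) → Fin k → ℕ
  rank i x = level i (splitAt (suc n) x) * k + toℕ x

  rank-< : ∀ i {x y} → level i (splitAt (suc n) x) < level i (splitAt (suc n) y) → rank i x < rank i y
  rank-< i {x} {y} l<l = lexicographic-< (toℕ y) l<l (Finₚ.toℕ<n x)

  rank-injective : ∀ i {x y} → rank i x ≡ rank i y → x ≡ y
  rank-injective i {x} {y} e
    with ℕₚ.<-cmp (level i (splitAt (suc n) x)) (level i (splitAt (suc n) y))
  ... | tri< lt _ _ = contradiction (rank-< i {x} {y} lt) (ℕₚ.<-irrefl e)
  ... | tri> _ _ gt = contradiction (rank-< i {y} {x} gt) (ℕₚ.<-irrefl (sym e))
  ... | tri≈ _ eq _ = Finₚ.toℕ-injective (ℕₚ.+-cancelˡ-≡ (level i (splitAt (suc n) y) * k) _ _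
          (trans (cong (λ l → l * k + toℕ x) (sym eq)) e))

  slack : Fin (suc n) → Fin k
  slack j = j ↑ˡ m

  contract : Fin m → Fin k
  contract c = suc n ↑ʳ c

  split-slack : ∀ j → splitAt (suc n) (slack j) ≡ inj₁ j
  split-slack j = Finₚ.splitAt-↑ˡ (suc n) j m

  split-contract : ∀ c → splitAt (suc n) (contract c) ≡ inj₂ c
  split-contract c = Finₚ.splitAt-↑ʳ (suc n) m c

  label : Fin k → Fin (suc n)
  label x = [ id , proj₁ ∘ participant ]′ (splitAt (suc n) x)

  label-slack : ∀ i → label (slack i) ≡ i
  label-slack i = cong [ id , proj₁ ∘ participant ]′ (split-slack i)

  slack-or-contract : ∀ x → (∃[ j ] slack j ≡ x) ⊎ (∃[ c ] contract c ≡ x)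
  slack-or-contract x with splitAt (suc n) x in eq
  ... | inj₁ j = inj₁ (j , Finₚ.splitAt⁻¹-↑ˡ eq)
  ... | inj₂ c = inj₂ (c , Finₚ.splitAt⁻¹-↑ʳ eq)

  slack-first : ∀ i x → x ≢ slack i → rank i (slack i) < rank i x
  slack-first i x x≢ = rank-< i {slack i} {x}
    (subst (_< level i (splitAt (suc n) x))
      (sym (trans (cong (level i) (split-slack i)) (level-own-slack i))) positive)
    where
    positive : 0 < level i (splitAt (suc n) x)
    positive with slack-or-contract x
    ... | inj₁ (j , refl) rewrite split-slack j | level-other-slack {i} {j} (x≢ ∘ cong slack ∘ sym) = s≤s z≤n
    ... | inj₂ (c , refl) rewrite split-contract c = proj₁ (level-contract i c)

  slack-least : ∀ i x → rank i (slack i) ≤ rank i x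
  slack-least i x with x Fin.≟ slack i
  ... | yes refl = ℕₚ.≤-refl
  ... | no  x≢   = ℕₚ.<⇒≤ (slack-first i x x≢)

  slack-greatest : ∀ {i j} x → slack (label x) ≢ x → i ≢ j → rank i x < rank i (slack j)
  slack-greatest {i} {j} x not-slack i≢j with slack-or-contract x
  ... | inj₁ (l , refl) = contradiction (cong slack (label-slack l)) not-slack
  ... | inj₂ (c , refl) = rank-< i {x} {slack j}
        (subst₂ _<_ (cong (level i) (sym (split-contract c)))
          (sym (trans (cong (level i) (split-slack j)) (level-other-slack i≢j)))
          (proj₂ (level-contract i c)))

  rank-contract-< : ∀ i {c d} → level i (inj₂ c) < level i (inj₂ d) →
                    rank i (contract c) < rank i (contract d)
  rank-contract-< i {c} {d} = rank-< i {contract c} {contract d} ∘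
    subst₂ _<_ (cong (level i) (sym (split-contract c))) (cong (level i) (sym (split-contract d)))

  rejected⇒rank-< : ∀ {i a d} → i ∈ P a → i ∈ P d → Rejected i a d →
                    rank i (contract a) < rank i (contract d)
  rejected⇒rank-< {i} a∈ d∈ rej = rank-contract-< i
    (subst₂ _<_ (sym (level-member a∈)) (sym (level-member d∈)) (s≤s (below-< a∈ d∈ rej)))

  member-before-nonmember : ∀ {i c d} → i ∈ P c → i ∉ P d → rank i (contract c) < rank i (contract d)
  member-before-nonmember {i} {c} c∈ d∉ = rank-contract-< i
    (subst₂ _<_ (sym (level-member c∈)) (sym (level-nonmember d∉)) (s≤s (s≤s (∣p∣≤n (below i c)))))

  -- From a fully labelled room to a meta-stable set.

  open Pivoting rank rank-injective slack label label-slack slack-least slack-greatest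
    using (Room; fullyLabelledRoom)

  module _ {t : Fin (suc n) → Fin k} (T : Room t) (labels : ∀ i → ∃[ b ] label (t b) ≡ i) where

    open Room T

    inRoom? : Decidable (λ c → ∃[ b ] t b ≡ contract c)
    inRoom? c = Finₚ.any? (λ b → t b Fin.≟ contract c)

    contracts : Subset m
    contracts = comprehension inRoom?

    -- The element labelled `i` is at or above `t i` in row `i`. As a slack it would be `slack i`,
    -- strictly below every contract there; so it is a contract with chosen participant `i`.
    covered : ∀ {i d} → rank i (contract d) ≤ rank i (t i) →
              ∃[ c ] c ∈ contracts × i ∈ P c × rank i (contract d) ≤ rank i (contract c)
    covered {i} {d} le with labels i
    ... | b , lb with slack-or-contract (t b) | ℕₚ.≤-trans le (minimal-≤ i b)
    ...   | inj₁ (j , e) | le-b = contradiction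
            (slack-first i (contract d) contract≢slack)
            (ℕₚ.≤⇒≯ (subst (λ x → rank i (contract d) ≤ rank i x) tb≡slack le-b))
      where
      tb≡slack : t b ≡ slack i
      tb≡slack = trans (sym e) (cong slack (trans (sym (label-slack j)) (trans (cong label e) lb)))
      contract≢slack : contract d ≢ slack i
      contract≢slack e′ with () ← trans (sym (split-contract d)) (trans (cong (splitAt (suc n)) e′) (split-slack i))
    ...   | inj₂ (c , e) | le-b = c , ∈-comprehension⁺ inRoom? (b , sym e) , i∈c
            , subst (λ x → rank i (contract d) ≤ rank i x) (sym e) le-b
      where
      label≡ : label (contract c) ≡ proj₁ (participant c)
      label≡ = cong [ id , proj₁ ∘ participant ]′ (split-contract c)
      i∈c : i ∈ P c
      i∈c = subst (_∈ P c) (trans (sym label≡) (trans (cong label e) lb)) (proj₂ (participant c))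

    contracts-metaStable : MetaStable P f contracts
    contracts-metaStable d dominates
      with i , le ← dominating (contract d)
      with c , c∈S , i∈c , d≤c ← covered le
      with i ∈? P d
    -- Contracts without `i` rank above all contracts of `i`, in particular above `c`.
    ... | no  i∉d = contradiction (member-before-nonmember i∈c i∉d) (ℕₚ.≤⇒≯ d≤c)
    ... | yes i∈d with dominates i i∈d
    ...   | inj₁ empty = ∉⊥ (subst (c ∈_) empty (x∈p∩q⁺ (c∈S , contractsOf⁺ i∈c)))
    ...   | inj₂ (a , a∈ , rej)
          with a∈S , a∈X ← x∈p∩q⁻ contracts (contractsOf P i) a∈
          with b , tb ← ∈-comprehension⁻ inRoom? a∈S
          -- Rejection puts `a` strictly below `d` in row `i`, yet `d` is at or below the row
          -- minimum `t i`, hence at or below `a`.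
          = contradiction (rejected⇒rank-< (contractsOf⁻ a∈X) i∈d rej)
              (ℕₚ.≤⇒≯ (subst (λ x → rank i (contract d) ≤ rank i x) tb (ℕₚ.≤-trans le (minimal-≤ i b))))

  metaStable : ∃ λ S → MetaStable P f S
  metaStable = from-room fullyLabelledRoom
    where
    from-room : ∃[ t ] Room t × (∀ i → ∃[ b ] label (t b) ≡ i) → ∃ λ S → MetaStable P f S
    from-room (t , T , labels) = contracts T labels , contracts-metaStable T labels

theorem5p1 : (n m : ℕ) (P : Fin m → Subset n)
    → (∀ c → Nonempty (P c))
    → (f : Fin n → Subset m → Subset m)
    → (∀ i → IsChoiceFunction (contractsOf P i) (f i))
    → (∀ i → IsPlott (contractsOf P i) (f i))
    → (∀ i → IsNonEmptyValued (contractsOf P i) (f i))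
    → ∃ λ S → MetaStable P f S
-- Without agents there are no contracts, since each has a participant. Otherwise there is a row
-- zero to pivot from.
theorem5p1 zero    m P participant f choice plott nonEmpty =
  ⊥ , λ d _ → Finₚ.¬Fin0 (proj₁ (participant d))
theorem5p1 (suc n) m P participant f choice plott nonEmpty =
  MetaStability.metaStable P participant f choice plott nonEmpty
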